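{- Let $\mathcal{L}$ be a list of $n$ elements, let $1\le r\le n$, and let $\mathcal{O}=\{o_1,\ldots,o_p\}$ be an order set for $\mathcal{L}$. Run the algorithm (build $CountArray$ from $\mathcal{L}$ and $\mathcal{O}$, then call $\mathrm{APR}(1)$). Then every array $\mathcal{R}[1,\ldots,r]$ printed by the algorithm is a valid $r$-permutation of $\mathcal{L}$, i.e. an arrangement of exactly $r$ elements taken from $\mathcal{L}$, in which no element is used more times than it occurs in $\mathcal{L}$.
   Context: A list is a finite collection of elements, possibly with repetitions; a set has no repetitions. The input consists of: a list $\mathcal{L}=\{l_1,\ldots,l_n\}$ containing exactly $p\le n$ distinct elements; an integer $r$ with $1\le r\le n$; and an order set $\mathcal{O}=\{o_1,\ldots,o_p\}$, which is the sequence of the $p$ distinct elements of $\mathcal{L}$, each listed once, in some chosen sequence. For an element $e$ of $\mathcal{L}$, $\mathcal{I}_{\mathcal{O}}(e)$ is the index $x$ with $o_x=e$. An $r$-permutation of $\mathcal{L}$ is an arrangement, in any order, of exactly $r$ elements of the list $\mathcal{L}$, viewed as a sequence of length $r$ of values (each value used at most as many times as it occurs in $\mathcal{L}$). The algorithm. Stage 1: build an integer array $CountArray[1\ldots p]$, initialised to $0$; for $i=1,\ldots,n$, increase $CountArray[\mathcal{I}_{\mathcal{O}}(l_i)]$ by $1$. Thus $CountArray[i]$ is the number of occurrences of $o_i$ in $\mathcal{L}$. Stage 2: call $\mathrm{APR}(1)$, where $\mathrm{APR}(index)$ is the following recursive procedure, with global data $CountArray$, $\mathcal{O}$, $r$,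 $p$ and an output array $\mathcal{R}$, and with $index$ and the loop variable $i$ local to each call. If $index>r$: print $\mathcal{R}[1,\ldots,r]$ and return. Otherwise, for $i=1,2,\ldots,p$ in this order: if $CountArray[i]\ge 1$, then perform successively $\mathcal{R}[index]\gets o_i$; $CountArray[i]\gets CountArray[i]-1$; call $\mathrm{APR}(index+1)$; $CountArray[i]\gets CountArray[i]+1$. -}

module Defs where

open import Data.Bool.Base using (if_then_else_)
open import Data.Fin.Base using (Fin; fromℕ<)
open import Data.List.Base as List using (List; []; _∷ʳ_)
open import Data.Nat.Base using (ℕ; suc; pred; _∸_; _≤_; _<_)
open import Data.Nat.Induction using (Acc; acc; <-wellFounded)
open import Data.Nat.Properties using (_≤?_; _<?_; n<1+n; ∸-monoʳ-<)
open import Data.Vec.Base using (Vec; lookup; replicate; count; _[_]%=_; _[_]≔_)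
open import Data.Vec.Membership.Propositional using (_∈_)
open import Data.Vec.Membership.Propositional.Properties using (∈-lookup)
open import Data.Vec.Relation.Unary.Any using (index)
open import Data.Vec.Relation.Unary.Any.Properties using (lookup-index)
open import Data.Vec.Relation.Unary.Unique.Propositional using (Unique)
open import Level using (Level)
open import Relation.Binary.Definitions using (DecidableEquality)
open import Relation.Binary.PropositionalEquality using (_≡_; sym)
open import Relation.Nullary.Decidable.Core using (does; yes; no)

private variable
  a : Level
  A : Set a
  n p r : ℕ

record OrderSet {A : Set a} {n : ℕ} (L : Vec A n) (p : ℕ) : Set a where
  field
    elements : Vec A p
    unique   : Unique elements
    sound    : ∀ {e} → e ∈ elements → e ∈ L
    complete : ∀ {e} → e ∈ L → e ∈ elements

  indexOf : ∀ {e} → e ∈ L → Fin p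
  indexOf e∈L = index (complete e∈L)

  lookup-indexOf : ∀ {e} (e∈L : e ∈ L) → lookup elements (indexOf e∈L) ≡ e
  lookup-indexOf e∈L = sym (lookup-index (complete e∈L))

open OrderSet public

-- Having exactly r entries is expressed by the type Vec A r.
record IsPermutationOf {A : Set a} (_≟_ : DecidableEquality A)
                       {n r : ℕ} (L : Vec A n) (R : Vec A r) : Set a where
  field
    fromList     : ∀ {e} → e ∈ R → e ∈ L
    multiplicity : ∀ e → count (e ≟_) R ≤ count (e ≟_) L

initialCounts : (L : Vec A n) → OrderSet L p → Vec ℕ p
initialCounts {n = n} {p = p} L O =
  List.foldl (λ c i → c [ indexOf O (∈-lookup i L) ]%= suc)
             (replicate p 0) (List.allFin n)

-- The global memory of the algorithm; `printed` lists the outputs so far,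
-- earliest first.
record State (A : Set a) (p r : ℕ) : Set a where
  constructor state
  field
    countArray : Vec ℕ p
    result     : Vec A r
    printed    : List (Vec A r)

open State public

print : State A p r → State A p r
print σ = record σ { printed = printed σ ∷ʳ result σ }

use : Vec A p → Fin r → Fin p → State A p r → State A p r
use o pos i σ = record σ
  { result     = result σ [ pos ]≔ lookup o i
  ; countArray = countArray σ [ i ]%= pred
  }

restore : Fin p → State A p r → State A p r
restore i σ = record σ { countArray = countArray σ [ i ]%= suc }

-- One iteration of the loop, with `recurse` standing for the recursive call.
-- The guard ensures that `pred` is only ever applied to a positive count.
iteration : Vec A p → Fin r → (State A p r → State A p r) →
            State A p r → Fin p → State A p r
iteration o pos recurse σ i =
  if does (1 ≤? lookup (countArray σ) i)
  then restore i (recurse (use o pos i σ))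
  else σ

-- Arrays are indexed from 0, so the initial call is at index 0 and the test
-- "index > r" of the 1-based version becomes the failure of idx < r.
-- The Acc argument only serves to justify termination.
apr : Vec A p → (idx : ℕ) → Acc _<_ (r ∸ idx) → State A p r → State A p r
apr {p = p} {r = r} o idx (acc rec) σ with idx <? r
... | no  _     = print σ
... | yes idx<r =
  List.foldl (iteration o (fromℕ< idx<r) (apr o (suc idx) (rec (∸-monoʳ-< (n<1+n idx) idx<r))))
             σ (List.allFin p)

-- R₀ is the arbitrary content of the output array before the run.
output : (L : Vec A n) → OrderSet L p → (R₀ : Vec A r) → List (Vec A r)
output {r = r} L O R₀ =
  printed (apr (elements O) 0 (<-wellFounded (r ∸ 0)) (state (initialCounts L O) R₀ []))

{-# OPTIONS --safe #-}

-- Throughout the run, the elements still available according to the count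
-- array together with the filled part of the output array form a
-- rearrangement of L.  A call of APR leaves both the count array and the
-- part of the output array below its index as it found them, so the invariant
-- survives the loop; at a print it exhibits the output array as part of a
-- rearrangement of L, which bounds all multiplicities.
module Submission where

open import Defs
open import Data.Bool.Base using (true; false)
open import Data.Fin.Base using (Fin; zero; suc; fromℕ<)
import Data.List.Base as List
open List using (List; []; _∷_; _++_; _∷ʳ_)
open import Data.List.Membership.Propositional using (_∈_)
import Data.List.Membership.Propositional.Properties as List
open import Data.List.Properties
  using (filter-++; length-++; ++-identityʳ; map-tabulate; take-all; take-take)
open import Data.List.Relation.Binary.Permutation.Propositional
  using (_↭_; ↭-refl; ↭-reflexive; ↭-sym; ↭-trans; module PermutationReasoning)
open import Data.List.Relation.Binary.Permutation.Propositional.Properties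
  using (∈-resp-↭; ↭-length; filter-↭; shift; ++⁺ˡ; ++⁺ʳ; ∷↭∷ʳ)
open import Data.List.Relation.Unary.All as All using (All; [])
open import Data.List.Relation.Unary.All.Properties using (∷ʳ⁺)
open import Data.Nat.Base using (ℕ; suc; pred; _+_; _∸_; _≤_; _<_; z<s; s<s⁻¹; >-nonZero)
open import Data.Nat.Induction using (Acc; acc; <-wellFounded)
open import Data.Nat.Properties
  using (_<?_; n<1+n; ∸-monoʳ-<; m≤n+m; ≮⇒≥; suc-pred; m≤n⇒m⊓n≡m; n≤1+n; module ≤-Reasoning)
open import Data.Product.Base using (∃; _,_)
open import Data.Vec.Base
  using (Vec; []; _∷_; lookup; replicate; count; toList; _[_]%=_; _[_]≔_)
open import Data.Vec.Membership.Propositional.Properties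
  using (∈-lookup; ∈-toList⁺; ∈-toList⁻)
open import Data.Vec.Properties
  using (length-toList; updateAt-updateAt-local; updateAt-id)
open import Function.Base using (_∘_; id)
open import Level using (Level)
open import Relation.Binary.Definitions using (DecidableEquality)
open import Relation.Binary.PropositionalEquality
  using (_≡_; refl; sym; trans; cong; subst; module ≡-Reasoning)
open import Relation.Nullary.Decidable.Core using (does; yes; no)
open import Relation.Unary using (Pred; Decidable)

private variable
  a b ℓ : Level
  A : Set a
  B : Set b
  n p r : ℕ

-- Folds, counts and array prefixes.

foldl-preserves : (P : Pred B ℓ) {f : B → A → B} →
                  (∀ {y} x → P y → P (f y x)) →
                  ∀ {y} xs → P y → P (List.foldl f y xs)
foldl-preserves P step []       py = py
foldl-preserves P step (x ∷ xs) py = foldl-preserves P step xs (step x py)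

toList-tabulate-lookup : (xs : Vec A n) → List.tabulate (lookup xs) ≡ toList xs
toList-tabulate-lookup []       = refl
toList-tabulate-lookup (x ∷ xs) = cong (x ∷_) (toList-tabulate-lookup xs)

count≡length-filter : {P : Pred A ℓ} (P? : Decidable P) (xs : Vec A n) →
                      count P? xs ≡ List.length (List.filter P? (toList xs))
count≡length-filter P? []       = refl
count≡length-filter P? (x ∷ xs) with does (P? x)
... | true  = cong suc (count≡length-filter P? xs)
... | false = count≡length-filter P? xs

take-[]≔ : ∀ {i} (i<r : i < r) (R : Vec A r) (x : A) →
           List.take (suc i) (toList (R [ fromℕ< i<r ]≔ x)) ≡
           List.take i (toList R) ∷ʳ x
take-[]≔ {i = 0}     z<s (_ ∷ _) x = refl
take-[]≔ {i = suc i} i<r (y ∷ R) x = cong (y ∷_) (take-[]≔ (s<s⁻¹ i<r) R x)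

take-[]≔-below : ∀ {i} (i<r : i < r) (R : Vec A r) (x : A) →
                 List.take i (toList (R [ fromℕ< i<r ]≔ x)) ≡ List.take i (toList R)
take-[]≔-below {i = 0}     i<r R       x = refl
take-[]≔-below {i = suc i} i<r (y ∷ R) x = cong (y ∷_) (take-[]≔-below (s<s⁻¹ i<r) R x)

-- A recursive call at `suc i` guarantees one more entry than the loop at `i` has to preserve; this
-- discards it.
take-suc-cong⁻ : ∀ i (xs ys : List A) →
                 List.take (suc i) xs ≡ List.take (suc i) ys →
                 List.take i xs ≡ List.take i ys
take-suc-cong⁻ i xs ys eq = begin
  List.take i xs                       ≡⟨ take-take-suc xs ⟨
  List.take i (List.take (suc i) xs)   ≡⟨ cong (List.take i) eq ⟩
  List.take i (List.take (suc i) ys)   ≡⟨ take-take-suc ys ⟩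
  List.take i ys                       ∎
  where
  open ≡-Reasoning
  take-take-suc : ∀ zs → List.take i (List.take (suc i) zs) ≡ List.take i zs
  take-take-suc zs = trans (take-take i (suc i) zs)
    (cong (λ k → List.take k zs) (m≤n⇒m⊓n≡m (n≤1+n i)))

-- Positivity matters because `pred 0` is `0`: on a zero count, decrementing and then incrementing
-- would leave `1`.
[]%=-pred-suc : (c : Vec ℕ p) (i : Fin p) → 1 ≤ lookup c i →
                c [ i ]%= pred [ i ]%= suc ≡ c
[]%=-pred-suc c i 1≤cᵢ =
  trans (updateAt-updateAt-local i c (suc-pred _ {{>-nonZero 1≤cᵢ}})) (updateAt-id i c)

-- Count arrays read as multisets of elements.

available : Vec A p → Vec ℕ p → List A
available []      []      = []
available (x ∷ o) (k ∷ c) = List.replicate k x ++ available o c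

available-zero : (o : Vec A p) → available o (replicate p 0) ≡ []
available-zero []      = refl
available-zero (x ∷ o) = available-zero o

-- The increment lengthens one block of copies; `shift` carries the new copy to the front past the
-- earlier blocks.
available-suc : (o : Vec A p) (c : Vec ℕ p) (i : Fin p) →
                available o (c [ i ]%= suc) ↭ lookup o i ∷ available o c
available-suc (x ∷ o) (k ∷ c) zero    = ↭-refl
available-suc (x ∷ o) (k ∷ c) (suc i) = ↭-trans
  (++⁺ˡ (List.replicate k x) (available-suc o c i))
  (shift (lookup o i) (List.replicate k x) (available o c))

-- This is `available-suc` read backwards at the decremented array, whose increment gives back `c`.
available-pred : (o : Vec A p) (c : Vec ℕ p) (i : Fin p) → 1 ≤ lookup c i →
                 lookup o i ∷ available o (c [ i ]%= pred) ↭ available o c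
available-pred o c i 1≤cᵢ = ↭-trans
  (↭-sym (available-suc o (c [ i ]%= pred) i))
  (↭-reflexive (cong (available o) ([]%=-pred-suc c i 1≤cᵢ)))

-- The starting array `c` is arbitrary because each step of the left fold hands a changed array to
-- the induction hypothesis.
available-foldl : (o : Vec A p) (f : B → Fin p) (g : B → A) →
                  (∀ x → lookup o (f x) ≡ g x) → ∀ xs c →
                  available o (List.foldl (λ c x → c [ f x ]%= suc) c xs) ↭
                  List.map g xs ++ available o c
available-foldl o f g of≗g []       c = ↭-refl
available-foldl o f g of≗g (x ∷ xs) c = begin
  available o (List.foldl (λ c x → c [ f x ]%= suc) (c [ f x ]%= suc) xs)
    ↭⟨ available-foldl o f g of≗g xs (c [ f x ]%= suc) ⟩
  List.map g xs ++ available o (c [ f x ]%= suc)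
    ↭⟨ ++⁺ˡ (List.map g xs) (available-suc o c (f x)) ⟩
  List.map g xs ++ lookup o (f x) ∷ available o c
    ↭⟨ shift (lookup o (f x)) (List.map g xs) (available o c) ⟩
  lookup o (f x) ∷ List.map g xs ++ available o c
    ≡⟨ cong (_∷ List.map g xs ++ available o c) (of≗g x) ⟩
  g x ∷ List.map g xs ++ available o c ∎
  where open PermutationReasoning

-- Zero counts make nothing available, and each position of `L` then adds a copy of its own entry,
-- by `lookup-indexOf`.
available-initialCounts : (L : Vec A n) (O : OrderSet L p) →
                          available (elements O) (initialCounts L O) ↭ toList L
available-initialCounts {n = n} {p = p} L O = begin
  available (elements O) (initialCounts L O)
    ↭⟨ available-foldl (elements O) (λ i → indexOf O (∈-lookup i L)) (lookup L)
         (λ i → lookup-indexOf O (∈-lookup i L)) (List.allFin n) (replicate p 0) ⟩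
  List.map (lookup L) (List.allFin n) ++ available (elements O) (replicate p 0)
    ≡⟨ cong (List.map (lookup L) (List.allFin n) ++_) (available-zero (elements O)) ⟩
  List.map (lookup L) (List.allFin n) ++ []
    ≡⟨ ++-identityʳ _ ⟩
  List.map (lookup L) (List.allFin n)
    ≡⟨ map-tabulate id (lookup L) ⟩
  List.tabulate (lookup L)
    ≡⟨ toList-tabulate-lookup L ⟩
  toList L ∎
  where open PermutationReasoning

-- The invariant of the recursion.

module _ {A : Set a} (l : List A) where

  -- Multiset inclusion, with the complement as explicit witness.
  IsPart : List A → Set a
  IsPart xs = ∃ λ rest → rest ++ xs ↭ l

  Consistent : Vec A p → Vec ℕ p → List A → Set a
  Consistent o c xs = available o c ++ xs ↭ l

  -- One copy of the chosen element moves from the available ones to the end of the filled prefix,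
  -- so the combined multiset stays the same.
  Consistent-use : ∀ (o : Vec A p) c i {xs} → 1 ≤ lookup c i →
                   Consistent o c xs →
                   Consistent o (c [ i ]%= pred) (xs ∷ʳ lookup o i)
  Consistent-use o c i {xs} 1≤cᵢ con = begin
    available o (c [ i ]%= pred) ++ xs ∷ʳ lookup o i
      ↭⟨ ++⁺ˡ (available o (c [ i ]%= pred)) (∷↭∷ʳ (lookup o i) xs) ⟨
    available o (c [ i ]%= pred) ++ lookup o i ∷ xs
      ↭⟨ shift (lookup o i) (available o (c [ i ]%= pred)) xs ⟩
    lookup o i ∷ available o (c [ i ]%= pred) ++ xs
      ↭⟨ ++⁺ʳ xs (available-pred o c i 1≤cᵢ) ⟩
    available o c ++ xs
      ↭⟨ con ⟩
    l ∎
    where open PermutationReasoning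

  -- `c` and `xs` describe the state on entry to the call, while `σ` varies over the loop. Only
  -- entries below `idx` are compared, since later ones may be overwritten and are never restored.
  record Agrees (idx : ℕ) (c : Vec ℕ p) (xs : List A) (σ : State A p r) : Set a where
    field
      counts : countArray σ ≡ c
      prefix : List.take idx (toList (result σ)) ≡ List.take idx xs
      parts  : All (IsPart ∘ toList) (printed σ)

  open Agrees public

  -- Taking `recurse` as a parameter separates the loop body from the recursion on `Acc`. Its
  -- specification covers all `c′` and `ys` because each iteration calls it from its own snapshot.
  iteration-agrees :
    ∀ (o : Vec A p) {idx} (idx<r : idx < r) {c xs} (recurse : State A p r → State A p r) →
    (∀ {c′ ys σ} → Consistent o c′ (List.take (suc idx) ys) →
                   Agrees (suc idx) c′ ys σ → Agrees (suc idx) c′ ys (recurse σ)) →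
    Consistent o c (List.take idx xs) →
    ∀ {σ} i → Agrees idx c xs σ → Agrees idx c xs (iteration o (fromℕ< idx<r) recurse σ i)
  iteration-agrees o {idx} idx<r {c} {xs} recurse recurse-agrees con {σ} i inv
    -- Splitting on the count lets the guard in `iteration` compute; at `0` the state is unchanged.
    with lookup (countArray σ) i in cᵢ≡
  ... | 0     = inv
  ... | suc k = record
    { counts = begin
        countArray τ′ [ i ]%= suc             ≡⟨ cong (_[ i ]%= suc) (counts inv′) ⟩
        countArray σ [ i ]%= pred [ i ]%= suc ≡⟨ []%=-pred-suc (countArray σ) i 1≤cᵢ ⟩
        countArray σ                          ≡⟨ counts inv ⟩
        c                                     ∎
    ; prefix = begin
        List.take idx (toList (result τ′))    ≡⟨ take-suc-cong⁻ idx (toList (result τ′)) (toList (result τ)) (prefix inv′) ⟩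
        List.take idx (toList (result τ))     ≡⟨ take-[]≔-below idx<r (result σ) (lookup o i) ⟩
        List.take idx (toList (result σ))     ≡⟨ prefix inv ⟩
        List.take idx xs                      ∎
    ; parts = parts inv′
    }
    where
    open ≡-Reasoning
    τ τ′ : State A _ _
    τ  = use o (fromℕ< idx<r) i σ
    τ′ = recurse τ

    1≤cᵢ : 1 ≤ lookup (countArray σ) i
    1≤cᵢ = subst (1 ≤_) (sym cᵢ≡) z<s

    con-σ : Consistent o (countArray σ) (List.take idx (toList (result σ)))
    con-σ rewrite counts inv | prefix inv = con

    con-τ : Consistent o (countArray τ) (List.take (suc idx) (toList (result τ)))
    con-τ = subst (Consistent o (countArray τ)) (sym (take-[]≔ idx<r (result σ) (lookup o i)))
      (Consistent-use o (countArray σ) i 1≤cᵢ con-σ)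

    -- The snapshot is the very state `τ` in which the call starts, so counts and prefix agree on
    -- entry by `refl`.
    inv′ : Agrees (suc idx) (countArray τ) (toList (result τ)) τ′
    inv′ = recurse-agrees con-τ (record { counts = refl; prefix = refl; parts = parts inv })

  apr-agrees : ∀ (o : Vec A p) idx (ac : Acc _<_ (r ∸ idx)) {c xs} {σ : State A p r} →
               Consistent o c (List.take idx xs) →
               Agrees idx c xs σ → Agrees idx c xs (apr o idx ac σ)
  apr-agrees {p = p} {r = r} o idx (acc rec) {c} {xs} {σ} con inv with idx <? r
  ... | yes idx<r = foldl-preserves (Agrees idx c xs)
    -- `con` speaks only of the entry snapshot, so it serves every iteration alike.
    (iteration-agrees o idx<r _
      (apr-agrees o (suc idx) (rec (∸-monoʳ-< (n<1+n idx) idx<r))) con)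
    (List.allFin p) inv
  ... | no  idx≮r = record
    { counts = counts inv
    ; prefix = prefix inv
    -- Here `idx` is at least `r`, so the prefix is the whole array and the elements still available
    -- form the complement.
    ; parts  = ∷ʳ⁺ (parts inv) (available o c , subst (Consistent o c) prefix≡result con)
    }
    where
    prefix≡result : List.take idx xs ≡ toList (result σ)
    prefix≡result = trans (sym (prefix inv)) (take-all idx (toList (result σ))
      (subst (_≤ idx) (sym (length-toList (result σ))) (≮⇒≥ idx≮r)))

-- From the invariant to multiplicities.

output-parts : (L : Vec A n) (O : OrderSet L p) (R₀ : Vec A r) →
               All (IsPart (toList L) ∘ toList) (output L O R₀)
output-parts {r = r} L O R₀ =
  -- At index 0 the compared prefixes are empty, so `xs = []` works whatever `R₀` contains.
  parts (apr-agrees (toList L) (elements O) 0 (<-wellFounded (r ∸ 0)) {xs = []}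
    (↭-trans (↭-reflexive (++-identityʳ _)) (available-initialCounts L O))
    (record { counts = refl; prefix = refl; parts = [] }))

-- Filtering by equality with `e` respects permutations and distributes over `++`, so the copies of
-- `e` in `rest` and in `R` add up to those in `L`.
IsPart⇒IsPermutationOf : (_≟_ : DecidableEquality A) (L : Vec A n) (R : Vec A r) →
                         IsPart (toList L) (toList R) → IsPermutationOf _≟_ L R
IsPart⇒IsPermutationOf _≟_ L R (rest , rest++R↭L) = record
  { fromList     = λ e∈R →
      ∈-toList⁻ (∈-resp-↭ rest++R↭L (List.∈-++⁺ʳ rest (∈-toList⁺ e∈R)))
  ; multiplicity = multiplicity
  }
  where
  open ≤-Reasoning
  multiplicity : ∀ e → count (e ≟_) R ≤ count (e ≟_) L
  multiplicity e = begin
    count (e ≟_) R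
      ≡⟨ count≡length-filter (e ≟_) R ⟩
    List.length (filterₑ (toList R))
      ≤⟨ m≤n+m _ (List.length (filterₑ rest)) ⟩
    List.length (filterₑ rest) + List.length (filterₑ (toList R))
      ≡⟨ length-++ (filterₑ rest) ⟨
    List.length (filterₑ rest ++ filterₑ (toList R))
      ≡⟨ cong List.length (filter-++ (e ≟_) rest (toList R)) ⟨
    List.length (filterₑ (rest ++ toList R))
      ≡⟨ ↭-length (filter-↭ (e ≟_) rest++R↭L) ⟩
    List.length (filterₑ (toList L))
      ≡⟨ count≡length-filter (e ≟_) L ⟨
    count (e ≟_) L ∎
    where
    filterₑ : List _ → List _
    filterₑ = List.filter (e ≟_)

theorem1 : ∀ {a} {A : Set a} (_≟_ : DecidableEquality A)
    {n p r : ℕ} (L : Vec A n) (O : OrderSet L p) →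
    1 ≤ r → r ≤ n →
    (R₀ R : Vec A r) → R ∈ output L O R₀ →
    IsPermutationOf _≟_ L R
theorem1 _≟_ L O _ _ R₀ R R∈output =
  IsPart⇒IsPermutationOf _≟_ L R (All.lookup (output-parts L O R₀) R∈output)
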